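{- Let $G$ be a connected graph with exactly $(\Delta(G)+1)(\gamma(G)-1)+1\geq 4$ vertices. If $G$ is a vertex domination-critical graph, then $G$ is regular, $G$ is a hypo-efficient domination graph, and $G$ is a hypo-unique domination graph.
   Context: All graphs are finite, simple and undirected; $\Delta(G)$ is the maximum degree. A dominating set of $G$ is a set $D\subseteq V(G)$ such that every vertex not in $D$ has a neighbor in $D$; $\gamma(G)$ is the minimum size of a dominating set, and a dominating set of size $\gamma(G)$ is a $\gamma$-set. $G$ is vertex domination-critical if $\gamma(G-v)<\gamma(G)$ for every $v\in V(G)$. An efficient dominating set (EDS) of $G$ is a set $D\subseteq V(G)$ with $|N[v]\cap D|=1$ for every $v\in V(G)$, where $N[v]$ is the closed neighborhood of $v$. A graph $G$ is a hypo-efficient domination graph if $G$ has no EDS but $G-v$ has at least one EDS for every $v\in V(G)$. A graph $G$ is a hypo-unique domination graph if $G$ has at least two distinct $\gamma$-sets, but for every $v\in V(G)$ the graph $G-v$ has exactly one $\gamma$-set. -}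

module Defs where

open import Data.Nat using (ℕ; suc; _≤_; _<_)
open import Data.Bool using (Bool; true; false)
open import Data.Fin using (Fin)
open import Data.Fin.Subset using (Subset; _∈_; _∉_; _⊆_; ∣_∣; _∪_; _∩_; ⁅_⁆; ∁)
open import Data.Vec using (tabulate)
open import Data.Product using (Σ; ∃; _×_; _,_)
open import Data.Sum using (_⊎_)
import Data.Empty
open import Relation.Binary.PropositionalEquality using (_≡_; _≢_)

record Graph (n : ℕ) : Set where
  field
    adj    : Fin n → Fin n → Bool
    sym    : ∀ u v → adj u v ≡ adj v u
    irrefl : ∀ v → adj v v ≡ false
open Graph public

module _ {n : ℕ} (G : Graph n) where

  N : Fin n → Subset n
  N v = tabulate (λ u → adj G v u)

  N[_] : Fin n → Subset n
  N[ v ] = N v ∪ ⁅ v ⁆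

  deg : Fin n → ℕ
  deg v = ∣ N v ∣

  MaxDegree : ℕ → Set
  MaxDegree d = (∀ v → deg v ≤ d) × ∃ λ v → deg v ≡ d

  Regular : Set
  Regular = ∀ u v → deg u ≡ deg v

  data Reach : Fin n → Fin n → Set where
    here : ∀ {v} → Reach v v
    step : ∀ {u w v} → adj G u w ≡ true → Reach w v → Reach u v

  Connected : Set
  Connected = ∀ u v → Reach u v

  -- All notions below are for the induced subgraph G[S] on the vertex set S.
  -- G itself is G[⊤] (S = all vertices), and G - v is G[∁ ⁅ v ⁆].

  Dominating : Subset n → Subset n → Set
  Dominating S D = D ⊆ S × (∀ v → v ∈ S → v ∈ D ⊎ (∃ λ u → u ∈ D × adj G v u ≡ true))

  GammaSet : Subset n → Subset n → Set
  GammaSet S D = Dominating S D × (∀ D′ → Dominating S D′ → ∣ D ∣ ≤ ∣ D′ ∣)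

  DomNumber : Subset n → ℕ → Set
  DomNumber S k = (∃ λ D → Dominating S D × ∣ D ∣ ≡ k) × (∀ D → Dominating S D → k ≤ ∣ D ∣)

  -- efficient dominating set of G[S]: |N[v] ∩ D| = 1 for every v in S
  -- (D ⊆ S, so intersecting with N[v] in G equals the closed neighbourhood in G[S])
  EDS : Subset n → Subset n → Set
  EDS S D = D ⊆ S × (∀ v → v ∈ S → ∣ N[ v ] ∩ D ∣ ≡ 1)

  del : Fin n → Subset n
  del v = ∁ ⁅ v ⁆

  all : Subset n
  all = tabulate (λ _ → true)

  VertexDomCritical : Set
  VertexDomCritical = ∀ v k k′ → DomNumber all k → DomNumber (del v) k′ → k′ < k

  HypoEfficient : Set
  HypoEfficient = (∀ D → ¬EDS all D) × (∀ v → ∃ λ D → EDS (del v) D)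
    where
      ¬EDS : Subset n → Subset n → Set
      ¬EDS S D = EDS S D → Data.Empty.⊥

  HypoUnique : Set
  HypoUnique =
    (∃ λ D₁ → ∃ λ D₂ → GammaSet all D₁ × GammaSet all D₂ × D₁ ≢ D₂) ×
    (∀ v → ∃ λ D → GammaSet (del v) D × (∀ D′ → GammaSet (del v) D′ → D′ ≡ D))

{-# OPTIONS --safe #-}
-- For every vertex v take a minimum dominating set D_v of G - v. The closed
-- neighbourhoods of its at most γ - 1 members, each of size at most Δ + 1, cover
-- the (Δ + 1)(γ - 1) vertices of G - v, so they partition it, |D_v| = γ - 1, and
-- members of D_v have degree Δ. With M the closed adjacency matrix this says
-- M·1_{D_v} = 1 - e_v. Since M is symmetric, evaluating 1_{D_u}ᵀ M 1_{D_v} in two ways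
-- gives |D_u| - [v ∈ D_u] = |D_v| - [u ∈ D_v], that is, v ∈ D_u iff u ∈ D_v. Hence
-- every u lies in some D_v and so has degree Δ, and D_v is determined by the sets
-- D_u. The same pairing of D_v with an efficient dominating set E of G gives
-- |E| - [v ∈ E] = γ - 1 < |E|, so E would be the whole vertex set, which is absurd as
-- G has an edge vw; and w ∉ D_v ∪ {v}, so D_v ∪ {v} and D_w ∪ {w} are distinct γ-sets.
module Submission where

open import Defs renaming (sym to adj-sym)
open import Data.Nat using (ℕ; suc; _+_; _*_; _∸_; _≤_)
open import Data.Product using (_×_)
open import Relation.Binary.PropositionalEquality using (_≡_)

open import Data.Bool using (Bool; true; false; if_then_else_)
open import Data.Fin using (Fin; zero; suc)
open import Data.Fin.Properties using (_≟_)
open import Data.Fin.Subset using (Subset; ⊤; _∈_; _∉_; _⊆_; ∣_∣; _∪_; _∩_; ⁅_⁆; ∁; Nonempty)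
open import Data.Fin.Subset.Properties
open import Data.Nat using (zero; _<_; z≤n; s≤s; s≤s⁻¹; _<?_)
open import Data.Nat.Induction using (<-rec)
open import Data.Nat.Properties hiding (_≟_)
open import Data.Nat.Solver using (module +-*-Solver)
open import Data.Product using (∃; _,_; proj₁; proj₂)
open import Data.Sum using (_⊎_; inj₁; inj₂)
open import Data.Vec using ([]; _∷_; here; there; lookup)
open import Data.Vec.Properties using ([]=⇒lookup; lookup⇒[]=; lookup∘tabulate)
open import Function using (_∘_; case_of_)
open import Relation.Binary.PropositionalEquality using (_≢_; _≗_; refl; sym; trans; cong; cong₂; subst; module ≡-Reasoning)
open import Relation.Nullary using (¬_; Dec; yes; no; contradiction)
open import Relation.Nullary.Decidable using (_×-dec_; _⊎-dec_; _→-dec_)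
import Algebra.Properties.Semiring.Sum as Sum
import Data.Bool.Properties as Bool
import Data.Fin.Properties as Fin

open Sum +-*-semiring using (sum; sum-cong-≗; ∑-comm; *-distribˡ-sum; *-distribʳ-sum)

private
  variable
    n : ℕ

-- Inequalities between finite sums

sum-mono : {f g : Fin n → ℕ} → (∀ i → f i ≤ g i) → sum f ≤ sum g
sum-mono {zero}  f≤g = z≤n
sum-mono {suc n} f≤g = +-mono-≤ (f≤g zero) (sum-mono (f≤g ∘ suc))

-- Termwise bounds whose totals leave no slack leave none in any term. This turns one global count
-- into an equality at each vertex.
sum-squeeze : {f g : Fin n → ℕ} → (∀ i → f i ≤ g i) → sum g ≤ sum f → f ≗ g
sum-squeeze {suc n} {f} {g} f≤g ∑g≤∑f zero = ≤-antisym (f≤g zero)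
  (+-cancelʳ-≤ (sum (f ∘ suc)) (g zero) (f zero)
    (≤-trans (+-monoʳ-≤ (g zero) (sum-mono (f≤g ∘ suc))) ∑g≤∑f))
sum-squeeze {suc n} {f} {g} f≤g ∑g≤∑f (suc i) = sum-squeeze (f≤g ∘ suc)
  (+-cancelˡ-≤ (f zero) (sum (g ∘ suc)) (sum (f ∘ suc))
    (≤-trans (+-monoˡ-≤ (sum (g ∘ suc)) (f≤g zero)) ∑g≤∑f)) i

-- Indicator functions and cardinalities of subsets

indicator : Bool → ℕ
indicator b = if b then 1 else 0

χ : Subset n → Fin n → ℕ
χ p x = indicator (lookup p x)

∈⇒χ≡1 : ∀ {p : Subset n} {x} → x ∈ p → χ p x ≡ 1
∈⇒χ≡1 x∈p = cong indicator ([]=⇒lookup x∈p)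

∉⇒χ≡0 : ∀ {p : Subset n} {x} → x ∉ p → χ p x ≡ 0
∉⇒χ≡0 {p = p} {x} x∉p with lookup p x in eq
... | true  = contradiction (lookup⇒[]= x p eq) x∉p
... | false = refl

χ≡1⇒∈ : ∀ {p : Subset n} {x} → χ p x ≡ 1 → x ∈ p
χ≡1⇒∈ {p = p} {x} χ≡1 with lookup p x in eq
... | true = lookup⇒[]= x p eq

χ-injective : ∀ {p q : Subset n} → χ p ≗ χ q → p ≡ q
χ-injective χ≗ = ⊆-antisym
  (λ x∈p → χ≡1⇒∈ (trans (sym (χ≗ _)) (∈⇒χ≡1 x∈p)))
  (λ x∈q → χ≡1⇒∈ (trans (χ≗ _) (∈⇒χ≡1 x∈q)))

∣p∣≡sum-χ : ∀ (p : Subset n) → ∣ p ∣ ≡ sum (χ p)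
∣p∣≡sum-χ []          = refl
∣p∣≡sum-χ (true  ∷ p) = cong suc (∣p∣≡sum-χ p)
∣p∣≡sum-χ (false ∷ p) = ∣p∣≡sum-χ p

∣p∩q∣≡sum-χ*χ : ∀ (p q : Subset n) → ∣ p ∩ q ∣ ≡ sum (λ i → χ p i * χ q i)
∣p∩q∣≡sum-χ*χ []          []          = refl
∣p∩q∣≡sum-χ*χ (true  ∷ p) (true  ∷ q) = cong suc (∣p∩q∣≡sum-χ*χ p q)
∣p∩q∣≡sum-χ*χ (true  ∷ p) (false ∷ q) = ∣p∩q∣≡sum-χ*χ p q
∣p∩q∣≡sum-χ*χ (false ∷ p) (_     ∷ q) = ∣p∩q∣≡sum-χ*χ p q

∣p∪q∣+∣p∩q∣≡∣p∣+∣q∣ : ∀ (p q : Subset n) → ∣ p ∪ q ∣ + ∣ p ∩ q ∣ ≡ ∣ p ∣ + ∣ q ∣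
∣p∪q∣+∣p∩q∣≡∣p∣+∣q∣ []          []          = refl
∣p∪q∣+∣p∩q∣≡∣p∣+∣q∣ (true  ∷ p) (true  ∷ q) = cong suc
  (trans (+-suc ∣ p ∪ q ∣ _) (trans (cong suc (∣p∪q∣+∣p∩q∣≡∣p∣+∣q∣ p q)) (sym (+-suc ∣ p ∣ _))))
∣p∪q∣+∣p∩q∣≡∣p∣+∣q∣ (true  ∷ p) (false ∷ q) = cong suc (∣p∪q∣+∣p∩q∣≡∣p∣+∣q∣ p q)
∣p∪q∣+∣p∩q∣≡∣p∣+∣q∣ (false ∷ p) (true  ∷ q) =
  trans (cong suc (∣p∪q∣+∣p∩q∣≡∣p∣+∣q∣ p q)) (sym (+-suc ∣ p ∣ _))
∣p∪q∣+∣p∩q∣≡∣p∣+∣q∣ (false ∷ p) (false ∷ q) = ∣p∪q∣+∣p∩q∣≡∣p∣+∣q∣ p q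

∣p∩∁q∣+∣p∩q∣≡∣p∣ : ∀ (p q : Subset n) → ∣ p ∩ ∁ q ∣ + ∣ p ∩ q ∣ ≡ ∣ p ∣
∣p∩∁q∣+∣p∩q∣≡∣p∣ []          []          = refl
∣p∩∁q∣+∣p∩q∣≡∣p∣ (true  ∷ p) (true  ∷ q) =
  trans (+-suc ∣ p ∩ ∁ q ∣ _) (cong suc (∣p∩∁q∣+∣p∩q∣≡∣p∣ p q))
∣p∩∁q∣+∣p∩q∣≡∣p∣ (true  ∷ p) (false ∷ q) = cong suc (∣p∩∁q∣+∣p∩q∣≡∣p∣ p q)
∣p∩∁q∣+∣p∩q∣≡∣p∣ (false ∷ p) (_     ∷ q) = ∣p∩∁q∣+∣p∩q∣≡∣p∣ p q

x∈p⇒1≤∣p∣ : ∀ {p : Subset n} {x} → x ∈ p → 1 ≤ ∣ p ∣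
x∈p⇒1≤∣p∣ {p = p} {x} x∈p = subst (_≤ ∣ p ∣) (∣⁅x⁆∣≡1 x)
  (p⊆q⇒∣p∣≤∣q∣ λ y∈⁅x⁆ → subst (_∈ p) (sym (x∈⁅y⁆⇒x≡y x y∈⁅x⁆)) x∈p)

1≤∣p∣⇒Nonempty : ∀ (p : Subset n) → 1 ≤ ∣ p ∣ → Nonempty p
1≤∣p∣⇒Nonempty (true  ∷ p) _   = zero , here
1≤∣p∣⇒Nonempty (false ∷ p) 1≤∣p∣ with x , x∈p ← 1≤∣p∣⇒Nonempty p 1≤∣p∣ = suc x , there x∈p

∣p∪⁅x⁆∣≤1+∣p∣ : ∀ (p : Subset n) x → ∣ p ∪ ⁅ x ⁆ ∣ ≤ suc ∣ p ∣
∣p∪⁅x⁆∣≤1+∣p∣ p x = begin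
  ∣ p ∪ ⁅ x ⁆ ∣                    ≤⟨ m≤m+n _ _ ⟩
  ∣ p ∪ ⁅ x ⁆ ∣ + ∣ p ∩ ⁅ x ⁆ ∣    ≡⟨ ∣p∪q∣+∣p∩q∣≡∣p∣+∣q∣ p ⁅ x ⁆ ⟩
  ∣ p ∣ + ∣ ⁅ x ⁆ ∣                ≡⟨ cong (∣ p ∣ +_) (∣⁅x⁆∣≡1 x) ⟩
  ∣ p ∣ + 1                        ≡⟨ +-comm ∣ p ∣ 1 ⟩
  suc ∣ p ∣                        ∎
  where open ≤-Reasoning

∣p∩⁅x⁆∣≡χ : ∀ (p : Subset n) x → ∣ p ∩ ⁅ x ⁆ ∣ ≡ χ p x
∣p∩⁅x⁆∣≡χ p x with x ∈? p
... | yes x∈p = trans (cong ∣_∣ (⊆-antisym (p∩q⊆q p ⁅ x ⁆) λ y∈ →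
        x∈p∩q⁺ (subst (_∈ p) (sym (x∈⁅y⁆⇒x≡y x y∈)) x∈p , y∈)))
      (trans (∣⁅x⁆∣≡1 x) (sym (∈⇒χ≡1 x∈p)))
... | no x∉p = trans (n<1⇒n≡0 (≰⇒> λ 1≤ →
        let y , y∈ = 1≤∣p∣⇒Nonempty (p ∩ ⁅ x ⁆) 1≤
            y∈p , y∈x = x∈p∩q⁻ p ⁅ x ⁆ y∈
        in x∉p (subst (_∈ p) (x∈⁅y⁆⇒x≡y x y∈x) y∈p)))
      (sym (∉⇒χ≡0 x∉p))

∣p∩∁⁅x⁆∣+χ≡∣p∣ : ∀ (p : Subset n) x → ∣ p ∩ ∁ ⁅ x ⁆ ∣ + χ p x ≡ ∣ p ∣
∣p∩∁⁅x⁆∣+χ≡∣p∣ p x =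
  trans (cong (∣ p ∩ ∁ ⁅ x ⁆ ∣ +_) (sym (∣p∩⁅x⁆∣≡χ p x))) (∣p∩∁q∣+∣p∩q∣≡∣p∣ p ⁅ x ⁆)

-- Closed neighbourhoods and double counting

module _ (G : Graph n) where

  ∈all : ∀ v → v ∈ all G
  ∈all v = lookup⇒[]= v (all G) (lookup∘tabulate _ v)

  ∈N⁺ : ∀ {u v} → adj G u v ≡ true → v ∈ N G u
  ∈N⁺ {u} {v} e = lookup⇒[]= v (N G u) (trans (lookup∘tabulate _ v) e)

  ∈N⁻ : ∀ {u v} → v ∈ N G u → adj G u v ≡ true
  ∈N⁻ {u} {v} v∈N = trans (sym (lookup∘tabulate _ v)) ([]=⇒lookup v∈N)

  v∉N[v] : ∀ v → v ∉ N G v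
  v∉N[v] v v∈N = case trans (sym (irrefl G v)) (∈N⁻ v∈N) of λ ()

  ∈N[]-sym : ∀ {u v} → v ∈ N[ G ] u → u ∈ N[ G ] v
  ∈N[]-sym {u} {v} v∈ with x∈p∪q⁻ (N G u) ⁅ u ⁆ v∈
  ... | inj₁ v∈N = x∈p∪q⁺ (inj₁ (∈N⁺ (trans (adj-sym G v u) (∈N⁻ v∈N))))
  ... | inj₂ v∈u with refl ← x∈⁅y⁆⇒x≡y u v∈u = v∈

  χ-N[]-sym : ∀ u v → χ (N[ G ] u) v ≡ χ (N[ G ] v) u
  χ-N[]-sym u v with v ∈? N[ G ] u
  ... | yes v∈ = trans (∈⇒χ≡1 v∈) (sym (∈⇒χ≡1 (∈N[]-sym v∈)))
  ... | no  v∉ = trans (∉⇒χ≡0 v∉) (sym (∉⇒χ≡0 (v∉ ∘ ∈N[]-sym)))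

  ∣N[v]∣≡1+deg : ∀ v → ∣ N[ G ] v ∣ ≡ suc (deg G v)
  ∣N[v]∣≡1+deg v = begin
    ∣ N[ G ] v ∣                              ≡⟨ +-identityʳ _ ⟨
    ∣ N[ G ] v ∣ + 0                          ≡⟨ cong (∣ N[ G ] v ∣ +_) (∉⇒χ≡0 (v∉N[v] v)) ⟨
    ∣ N[ G ] v ∣ + χ (N G v) v                ≡⟨ cong (∣ N[ G ] v ∣ +_) (∣p∩⁅x⁆∣≡χ (N G v) v) ⟨
    ∣ N[ G ] v ∣ + ∣ N G v ∩ ⁅ v ⁆ ∣          ≡⟨ ∣p∪q∣+∣p∩q∣≡∣p∣+∣q∣ (N G v) ⁅ v ⁆ ⟩
    deg G v + ∣ ⁅ v ⁆ ∣                       ≡⟨ cong (deg G v +_) (∣⁅x⁆∣≡1 v) ⟩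
    deg G v + 1                               ≡⟨ +-comm (deg G v) 1 ⟩
    suc (deg G v)                             ∎
    where open ≡-Reasoning

  -- Both sides are the bilinear form of the closed adjacency matrix at the indicators of `D` and
  -- `E`; the matrix is symmetric by `χ-N[]-sym`.
  double-count : ∀ D E → sum (λ u → χ D u * ∣ N[ G ] u ∩ E ∣) ≡ sum (λ v → χ E v * ∣ N[ G ] v ∩ D ∣)
  double-count D E = begin
    sum (λ u → χ D u * ∣ N[ G ] u ∩ E ∣)                        ≡⟨ sum-cong-≗ (expand D E) ⟩
    sum (λ u → sum λ v → χ D u * (χ (N[ G ] u) v * χ E v))      ≡⟨ ∑-comm (λ u v → χ D u * (χ (N[ G ] u) v * χ E v)) ⟩
    sum (λ v → sum λ u → χ D u * (χ (N[ G ] u) v * χ E v))      ≡⟨ sum-cong-≗ (λ v → sum-cong-≗ λ u → swap u v) ⟩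
    sum (λ v → sum λ u → χ E v * (χ (N[ G ] v) u * χ D u))      ≡⟨ sum-cong-≗ (expand E D) ⟨
    sum (λ v → χ E v * ∣ N[ G ] v ∩ D ∣)                        ∎
    where
    open ≡-Reasoning
    expand : ∀ D E u → χ D u * ∣ N[ G ] u ∩ E ∣ ≡ sum (λ v → χ D u * (χ (N[ G ] u) v * χ E v))
    expand D E u = trans (cong (χ D u *_) (∣p∩q∣≡sum-χ*χ (N[ G ] u) E))
                         (*-distribˡ-sum (χ D u) (λ v → χ (N[ G ] u) v * χ E v))
    swap : ∀ u v → χ D u * (χ (N[ G ] u) v * χ E v) ≡ χ E v * (χ (N[ G ] v) u * χ D u)
    swap u v rewrite χ-N[]-sym u v =
      solve 3 (λ a b c → a :* (b :* c) := c :* (b :* a)) refl (χ D u) (χ (N[ G ] v) u) (χ E v)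
      where open +-*-Solver

  -- The matrix equation M·1_D = 1_S. Unlike `EDS` it also constrains vertices outside `S`: their
  -- closed neighbourhoods must miss `D`.
  ExactlyDominates : Subset n → Subset n → Set
  ExactlyDominates S D = ∀ u → ∣ N[ G ] u ∩ D ∣ ≡ χ S u

  -- Each of the two matrix equations evaluates one side of `double-count`.
  exact-swap : ∀ {S T D E} → ExactlyDominates S D → ExactlyDominates T E → ∣ D ∩ T ∣ ≡ ∣ E ∩ S ∣
  exact-swap {S} {T} {D} {E} exD exE = begin
    ∣ D ∩ T ∣                              ≡⟨ ∣p∩q∣≡sum-χ*χ D T ⟩
    sum (λ u → χ D u * χ T u)              ≡⟨ sum-cong-≗ (λ u → cong (χ D u *_) (exE u)) ⟨
    sum (λ u → χ D u * ∣ N[ G ] u ∩ E ∣)   ≡⟨ double-count D E ⟩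
    sum (λ u → χ E u * ∣ N[ G ] u ∩ D ∣)   ≡⟨ sum-cong-≗ (λ u → cong (χ E u *_) (exD u)) ⟩
    sum (λ u → χ E u * χ S u)              ≡⟨ ∣p∩q∣≡sum-χ*χ E S ⟨
    ∣ E ∩ S ∣                              ∎
    where open ≡-Reasoning

  -- By `exact-swap`, `D` without `v` and `E` without `u` have the same size, so sets of equal size
  -- lose equally much.
  exact-reciprocal : ∀ {u v D E} → ExactlyDominates (del G u) D → ExactlyDominates (del G v) E →
                     ∣ D ∣ ≡ ∣ E ∣ → χ D v ≡ χ E u
  exact-reciprocal {u} {v} {D} {E} exD exE ∣D∣≡∣E∣ = +-cancelˡ-≡ ∣ D ∩ del G v ∣ _ _ (begin
    ∣ D ∩ del G v ∣ + χ D v   ≡⟨ ∣p∩∁⁅x⁆∣+χ≡∣p∣ D v ⟩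
    ∣ D ∣                     ≡⟨ ∣D∣≡∣E∣ ⟩
    ∣ E ∣                     ≡⟨ ∣p∩∁⁅x⁆∣+χ≡∣p∣ E u ⟨
    ∣ E ∩ del G u ∣ + χ E u   ≡⟨ cong (_+ χ E u) (exact-swap exD exE) ⟨
    ∣ D ∩ del G v ∣ + χ E u   ∎)
    where open ≡-Reasoning

  -- Existence of minimum dominating sets

  dominating? : ∀ S D → Dec (Dominating G S D)
  dominating? S D = D ⊆? S ×-dec Fin.all? λ v →
    v ∈? S →-dec (v ∈? D ⊎-dec Fin.any? λ u → u ∈? D ×-dec adj G v u Bool.≟ true)

  -- Strong induction on the size `k`: a decidable search over all subsets either finds a smaller
  -- dominating set or certifies that `D` is minimum.
  minimum-below : ∀ S k D → Dominating G S D → ∣ D ∣ ≡ k → ∃ (GammaSet G S)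
  minimum-below S = <-rec _ λ k rec D dom ∣D∣≡k →
    case anySubset? (λ E → dominating? S E ×-dec ∣ E ∣ <? k) of λ where
      (yes (E , domE , ∣E∣<k)) → rec ∣E∣<k E domE refl
      (no ∄smaller) → D , dom , λ E domE → ≮⇒≥ λ ∣E∣<∣D∣ →
        ∄smaller (E , domE , subst (∣ E ∣ <_) ∣D∣≡k ∣E∣<∣D∣)

  gammaSet-exists : ∀ S → ∃ (GammaSet G S)
  gammaSet-exists S = minimum-below S ∣ S ∣ S ((λ v∈S → v∈S) , λ v v∈S → inj₁ v∈S) refl

  -- Tightness of the ball-counting bound

  dominating⇒χ≤ : ∀ {S D} → Dominating G S D → ∀ u → χ S u ≤ ∣ N[ G ] u ∩ D ∣
  dominating⇒χ≤ {S} {D} dom u with u ∈? S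
  ... | no u∉S rewrite ∉⇒χ≡0 u∉S = z≤n
  ... | yes u∈S rewrite ∈⇒χ≡1 u∈S with proj₂ dom u u∈S
  ...   | inj₁ u∈D             = x∈p⇒1≤∣p∣ (x∈p∩q⁺ (x∈p∪q⁺ {p = N G u} (inj₂ (x∈⁅x⁆ u)) , u∈D))
  ...   | inj₂ (w , w∈D , u~w) = x∈p⇒1≤∣p∣ (x∈p∩q⁺ (x∈p∪q⁺ {p = N G u} (inj₁ (∈N⁺ u~w)) , w∈D))

  sum-∣N[]∩D∣ : ∀ D → sum (λ u → ∣ N[ G ] u ∩ D ∣) ≡ sum (λ d → χ D d * ∣ N[ G ] d ∣)
  sum-∣N[]∩D∣ D = begin
    sum (λ u → ∣ N[ G ] u ∩ D ∣)            ≡⟨ sum-cong-≗ ⊤-weight ⟨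
    sum (λ u → χ ⊤ u * ∣ N[ G ] u ∩ D ∣)    ≡⟨ double-count ⊤ D ⟩
    sum (λ d → χ D d * ∣ N[ G ] d ∩ ⊤ ∣)    ≡⟨ sum-cong-≗ (λ d → cong (λ p → χ D d * ∣ p ∣) (∩-identityʳ (N[ G ] d))) ⟩
    sum (λ d → χ D d * ∣ N[ G ] d ∣)        ∎
    where
    open ≡-Reasoning
    ⊤-weight : ∀ u → χ ⊤ u * ∣ N[ G ] u ∩ D ∣ ≡ ∣ N[ G ] u ∩ D ∣
    ⊤-weight u = trans (cong (_* ∣ N[ G ] u ∩ D ∣) (∈⇒χ≡1 (∈⊤ {x = u}))) (*-identityˡ _)

  -- The chain |S| ≤ Σ_u |N[u] ∩ D| = Σ_{d ∈ D} |N[d]| ≤ |D|(Δ + 1) ≤ k(Δ + 1) = |S| closes up, so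
  -- every link is an equality. The first link gives exactness, the second the degrees, the third
  -- |D| = k.
  ball-count-tight : ∀ {Δ k S D} → (∀ v → deg G v ≤ Δ) → Dominating G S D → ∣ D ∣ ≤ k → ∣ S ∣ ≡ k * suc Δ →
                     ExactlyDominates S D × (∀ {d} → d ∈ D → deg G d ≡ Δ) × ∣ D ∣ ≡ k
  ball-count-tight {Δ} {k} {S} {D} deg≤Δ dom ∣D∣≤k ∣S∣≡ =
    (λ u → sym (sum-squeeze (dominating⇒χ≤ dom) (≤-trans balls≤ (≤-trans ∑D≤ (≤-reflexive k[1+Δ]≡))) u)) ,
    (λ {d} d∈D → suc-injective (begin
       suc (deg G d)            ≡⟨ ∣N[v]∣≡1+deg d ⟨
       ∣ N[ G ] d ∣             ≡⟨ *-identityˡ _ ⟨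
       1 * ∣ N[ G ] d ∣         ≡⟨ cong (_* ∣ N[ G ] d ∣) (∈⇒χ≡1 d∈D) ⟨
       χ D d * ∣ N[ G ] d ∣     ≡⟨ sum-squeeze ball≤ (≤-trans ∑D≤ (≤-trans (≤-reflexive k[1+Δ]≡) ≤balls)) d ⟩
       χ D d * suc Δ            ≡⟨ cong (_* suc Δ) (∈⇒χ≡1 d∈D) ⟩
       1 * suc Δ                ≡⟨ *-identityˡ _ ⟩
       suc Δ                    ∎)) ,
    ≤-antisym ∣D∣≤k (*-cancelʳ-≤ k ∣ D ∣ (suc Δ)
      (≤-trans (≤-reflexive k[1+Δ]≡) (≤-trans ≤balls (≤-trans (sum-mono ball≤) (≤-reflexive ∑D≡)))))
    where
    open ≡-Reasoning
    k[1+Δ]≡ : k * suc Δ ≡ sum (χ S)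
    k[1+Δ]≡ = trans (sym ∣S∣≡) (∣p∣≡sum-χ S)
    ball≤ : ∀ d → χ D d * ∣ N[ G ] d ∣ ≤ χ D d * suc Δ
    ball≤ d = *-monoʳ-≤ (χ D d) (subst (_≤ suc Δ) (sym (∣N[v]∣≡1+deg d)) (s≤s (deg≤Δ d)))
    ∑D≡ : sum (λ d → χ D d * suc Δ) ≡ ∣ D ∣ * suc Δ
    ∑D≡ = trans (sym (*-distribʳ-sum (suc Δ) (χ D))) (cong (_* suc Δ) (sym (∣p∣≡sum-χ D)))
    ∑D≤ : sum (λ d → χ D d * suc Δ) ≤ k * suc Δ
    ∑D≤ = ≤-trans (≤-reflexive ∑D≡) (*-monoˡ-≤ (suc Δ) ∣D∣≤k)
    balls≤ : sum (λ u → ∣ N[ G ] u ∩ D ∣) ≤ sum (λ d → χ D d * suc Δ)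
    balls≤ = ≤-trans (≤-reflexive (sum-∣N[]∩D∣ D)) (sum-mono ball≤)
    ≤balls : sum (χ S) ≤ sum (λ d → χ D d * ∣ N[ G ] d ∣)
    ≤balls = ≤-trans (sum-mono (dominating⇒χ≤ dom)) (≤-reflexive (sum-∣N[]∩D∣ D))

  -- Efficient domination, extension by a vertex, and neighbours

  exact⇒EDS : ∀ {S D} → D ⊆ S → ExactlyDominates S D → EDS G S D
  exact⇒EDS D⊆S ex = D⊆S , λ u u∈S → trans (ex u) (∈⇒χ≡1 u∈S)

  EDS-all⇒exact : ∀ {E} → EDS G (all G) E → ExactlyDominates (all G) E
  EDS-all⇒exact (_ , once) u = trans (once u (∈all u)) (sym (∈⇒χ≡1 (∈all u)))

  EDS⇒dominating : ∀ {S E} → EDS G S E → Dominating G S E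
  EDS⇒dominating {S} {E} (E⊆S , once) = E⊆S , covered
    where
    covered : ∀ v → v ∈ S → v ∈ E ⊎ ∃ λ u → u ∈ E × adj G v u ≡ true
    covered v v∈S
      with u , u∈ ← 1≤∣p∣⇒Nonempty (N[ G ] v ∩ E) (≤-reflexive (sym (once v v∈S)))
      with u∈N[v] , u∈E ← x∈p∩q⁻ (N[ G ] v) E u∈
      with x∈p∪q⁻ (N G v) ⁅ v ⁆ u∈N[v]
    ... | inj₁ u∈N = inj₂ (u , u∈E , ∈N⁻ u∈N)
    ... | inj₂ u∈v = inj₁ (subst (_∈ E) (x∈⁅y⁆⇒x≡y v u∈v) u∈E)

  dominating-del⇒all : ∀ {v D} → Dominating G (del G v) D → Dominating G (all G) (D ∪ ⁅ v ⁆)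
  dominating-del⇒all {v} {D} (_ , covers) = (λ _ → ∈all _) , λ u _ → covered u (u ≟ v)
    where
    covered : ∀ u → Dec (u ≡ v) → u ∈ D ∪ ⁅ v ⁆ ⊎ ∃ λ w → w ∈ D ∪ ⁅ v ⁆ × adj G u w ≡ true
    covered u (yes refl) = inj₁ (x∈p∪q⁺ (inj₂ (x∈⁅x⁆ u)))
    covered u (no u≢v) with covers u (x∉p⇒x∈∁p (x≢y⇒x∉⁅y⁆ u≢v))
    ... | inj₁ u∈D             = inj₁ (x∈p∪q⁺ (inj₁ u∈D))
    ... | inj₂ (w , w∈D , u~w) = inj₂ (w , x∈p∪q⁺ (inj₁ w∈D) , u~w)

  connected⇒neighbour : ∀ {u v} → u ≢ v → Reach G u v → ∃ λ w → adj G u w ≡ true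
  connected⇒neighbour u≢v here         = contradiction refl u≢v
  connected⇒neighbour u≢v (step u~w _) = _ , u~w

  adj⇒∣N[]∣≢1 : ∀ {u w} → adj G u w ≡ true → ∣ N[ G ] u ∣ ≢ 1
  adj⇒∣N[]∣≢1 {u} u~w ∣N∣≡1 = <⇒≢ (x∈p⇒1≤∣p∣ (∈N⁺ u~w))
    (sym (suc-injective (trans (sym (∣N[v]∣≡1+deg u)) ∣N∣≡1)))

-- The extremal critical graph, with γ = k + 1

module Extremal {n Δ k : ℕ} (G : Graph n)
  (deg≤Δ : ∀ v → deg G v ≤ Δ) (γ≡1+k : DomNumber G (all G) (suc k)) (n≡ : n ≡ suc (k * suc Δ))
  (1≤k : 1 ≤ k) (neighbour : ∀ u → ∃ λ w → adj G u w ≡ true) (critical : VertexDomCritical G) where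

  ∣del∣ : ∀ v → ∣ del G v ∣ ≡ k * suc Δ
  ∣del∣ v = trans (∣∁p∣≡n∸∣p∣ ⁅ v ⁆) (cong₂ _∸_ n≡ (∣⁅x⁆∣≡1 v))

  gammaSet-tight : ∀ {v D} → GammaSet G (del G v) D →
                   ExactlyDominates G (del G v) D × (∀ {d} → d ∈ D → deg G d ≡ Δ) × ∣ D ∣ ≡ k
  gammaSet-tight {v} {D} (dom , min) = ball-count-tight G deg≤Δ dom
    -- Criticality gives |D| < k + 1, which is the size bound `ball-count-tight` asks for.
    (s≤s⁻¹ (critical v (suc k) ∣ D ∣ γ≡1+k ((D , dom , refl) , min))) (∣del∣ v)

  γ-set : ∀ v → ∃ (GammaSet G (del G v))
  γ-set v = gammaSet-exists G (del G v)

  D : Fin n → Subset n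
  D v = proj₁ (γ-set v)

  D-dominating : ∀ v → Dominating G (del G v) (D v)
  D-dominating v = proj₁ (proj₂ (γ-set v))

  D-exact : ∀ v → ExactlyDominates G (del G v) (D v)
  D-exact v = proj₁ (gammaSet-tight (proj₂ (γ-set v)))

  ∣D∣ : ∀ v → ∣ D v ∣ ≡ k
  ∣D∣ v = proj₂ (proj₂ (gammaSet-tight (proj₂ (γ-set v))))

  -- Tightness gives degree Δ only to members of some `D u`. As `1≤k`, some `u` lies in `D v`, and
  -- reciprocity puts `v` in `D u`.
  deg≡Δ : ∀ v → deg G v ≡ Δ
  deg≡Δ v with u , u∈Dv ← 1≤∣p∣⇒Nonempty (D v) (subst (1 ≤_) (sym (∣D∣ v)) 1≤k) =
    proj₁ (proj₂ (gammaSet-tight (proj₂ (γ-set u))))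
      (χ≡1⇒∈ (trans (sym (exact-reciprocal G (D-exact v) (D-exact u) (trans (∣D∣ v) (sym (∣D∣ u)))))
                    (∈⇒χ≡1 u∈Dv)))

  regular : Regular G
  regular u v = trans (deg≡Δ u) (sym (deg≡Δ v))

  noEDS : Fin n → ∀ E → ¬ EDS G (all G) E
  noEDS v E eds = adj⇒∣N[]∣≢1 G (proj₂ (neighbour v)) (begin
    ∣ N[ G ] v ∣        ≡⟨ cong ∣_∣ (∩-identityʳ (N[ G ] v)) ⟨
    ∣ N[ G ] v ∩ ⊤ ∣    ≡⟨ cong (λ p → ∣ N[ G ] v ∩ p ∣) (⊆-antisym ⊆⊤ (λ _ → everything _)) ⟨
    ∣ N[ G ] v ∩ E ∣    ≡⟨ proj₂ eds v (∈all G v) ⟩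
    1                   ∎)
    where
    open ≡-Reasoning
    -- Swapping `E`, exact for the whole graph, with `D u` gives |E ∩ del u| = |D u ∩ all|.
    E∩del≤k : ∀ u → ∣ E ∩ del G u ∣ ≤ k
    E∩del≤k u = ≤-trans
      (≤-reflexive (exact-swap G (EDS-all⇒exact G eds) (D-exact u)))
      (≤-trans (∣p∩q∣≤∣p∣ (D u) (all G)) (≤-reflexive (∣D∣ u)))
    everything : ∀ u → u ∈ E
    everything u with u ∈? E
    ... | yes u∈E = u∈E
    -- If `E` misses `u`, deleting `u` costs nothing, so |E| ≤ k, although `E` dominates and thus
    -- has at least k + 1 members.
    ... | no  u∉E = contradiction (≤-trans (proj₂ γ≡1+k E (EDS⇒dominating G eds)) (≤-trans
            (≤-reflexive (trans (sym (∣p∩∁⁅x⁆∣+χ≡∣p∣ E u))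
              (trans (cong (∣ E ∩ del G u ∣ +_) (∉⇒χ≡0 u∉E)) (+-identityʳ _))))
            (E∩del≤k u))) 1+n≰n

  hypoEfficient : Fin n → HypoEfficient G
  hypoEfficient v = noEDS v , λ u → D u , exact⇒EDS G (proj₁ (D-dominating u)) (D-exact u)

  D∪⁅v⁆-gammaSet : ∀ v → GammaSet G (all G) (D v ∪ ⁅ v ⁆)
  D∪⁅v⁆-gammaSet v = dominating-del⇒all G (D-dominating v) , λ E domE →
    ≤-trans (∣p∪⁅x⁆∣≤1+∣p∣ (D v) v) (≤-trans (≤-reflexive (cong suc (∣D∣ v))) (proj₂ γ≡1+k E domE))

  -- Exactness at the deleted vertex `v` itself says that N[v] misses `D v`.
  neighbour∉D∪⁅v⁆ : ∀ {v w} → adj G v w ≡ true → w ∉ D v ∪ ⁅ v ⁆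
  neighbour∉D∪⁅v⁆ {v} {w} v~w w∈ with x∈p∪q⁻ (D v) ⁅ v ⁆ w∈
  ... | inj₁ w∈D = <⇒≢ (x∈p⇒1≤∣p∣ (x∈p∩q⁺ (x∈p∪q⁺ (inj₁ (∈N⁺ G v~w)) , w∈D)))
          (sym (trans (D-exact v v) (∉⇒χ≡0 (x∈p⇒x∉∁p (x∈⁅x⁆ v)))))
  ... | inj₂ w∈v = v∉N[v] G v (subst (_∈ N G v) (x∈⁅y⁆⇒x≡y v w∈v) (∈N⁺ G v~w))

  -- Reciprocity with `D u` equates the indicators of both `E` and `D v` at `u` with `χ (D u) v`.
  gammaSet-del-unique : ∀ {v E} → GammaSet G (del G v) E → E ≡ D v
  gammaSet-del-unique {v} {E} γE = χ-injective λ u →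
    trans (exact-reciprocal G {u = v} {v = u} exE (D-exact u) (trans ∣E∣ (sym (∣D∣ u))))
          (sym (exact-reciprocal G (D-exact v) (D-exact u) (trans (∣D∣ v) (sym (∣D∣ u)))))
    where
    exE = proj₁ (gammaSet-tight γE)
    ∣E∣ = proj₂ (proj₂ (gammaSet-tight γE))

  hypoUnique : Fin n → HypoUnique G
  hypoUnique v with w , v~w ← neighbour v =
    (D v ∪ ⁅ v ⁆ , D w ∪ ⁅ w ⁆ , D∪⁅v⁆-gammaSet v , D∪⁅v⁆-gammaSet w ,
      λ eq → neighbour∉D∪⁅v⁆ v~w (subst (w ∈_) (sym eq) (x∈p∪q⁺ (inj₂ (x∈⁅x⁆ w))))) ,
    λ u → D u , proj₂ (γ-set u) , λ _ → gammaSet-del-unique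

theorem3p18 : (n : ℕ) (G : Graph n) (Δ γ : ℕ) →
    MaxDegree G Δ → DomNumber G (all G) γ →
    n ≡ (Δ + 1) * (γ ∸ 1) + 1 → 4 ≤ n →
    Connected G → VertexDomCritical G →
    Regular G × HypoEfficient G × HypoUnique G
-- For γ ≤ 1 the truncated difference `γ ∸ 1` is 0, which forces n = 1.
theorem3p18 n G Δ 0 _ _ n≡ 4≤n _ _ rewrite *-zeroʳ (Δ + 1) | n≡ = case 4≤n of λ { (s≤s ()) }
theorem3p18 n G Δ 1 _ _ n≡ 4≤n _ _ rewrite *-zeroʳ (Δ + 1) | n≡ = case 4≤n of λ { (s≤s ()) }
theorem3p18 (suc (suc n)) G Δ (suc (suc k)) (deg≤Δ , _) γ≡ n≡ 4≤n conn crit =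
  regular , hypoEfficient zero , hypoUnique zero
  where
  neighbour : ∀ u → ∃ λ w → adj G u w ≡ true
  -- A walk to any other vertex starts with an edge; `zero` heads for `suc zero`, all others for
  -- `zero`.
  neighbour zero    = connected⇒neighbour G (λ ()) (conn zero (suc zero))
  neighbour (suc u) = connected⇒neighbour G (λ ()) (conn (suc u) zero)
  open +-*-Solver
  open Extremal G deg≤Δ γ≡
    (trans n≡ (solve 2 (λ d l → (d :+ con 1) :* l :+ con 1 := con 1 :+ l :* (con 1 :+ d)) refl Δ (suc k)))
    (s≤s z≤n) neighbour crit
theorem3p18 1 G Δ (suc (suc k)) _ _ _ (s≤s ()) _ _
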